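{- Let $A$ be a finite set with $|A|\ge2$ and let $n\ge2$. Let $\phi:[n]\to[n]$ be a transformation with $F$ fixed points. Then the manipulation of variables $f^\phi:A^n\to A^n$ can be computed with one memory cell in at most $n-F+1$ instructions, i.e. $\mathcal{L}(f^\phi|1)\le n-F+1$.
   Context: $[n]=\{1,\dots,n\}$; the image of $i$ under $\phi:[n]\to[n]$ is written $i\phi$. The manipulation of variables induced by $\phi$ is $f^\phi(x_1,\dots,x_n)=(x_{1\phi},\dots,x_{n\phi})$. For $N\ge1$, a transformation of $A^N$ is a map $h=(h_1,\dots,h_N):A^N\to A^N$; its coordinate function $h_i:A^N\to A$ is trivial if $h_i(x)=x_i$ for all $x$. An instruction of $A^N$ is a transformation of $A^N$ with at most one nontrivial coordinate function. A program of length $L$ computing $h$ is a sequence of instructions $g^1,\dots,g^L$ of $A^N$ with $h=g^L\circ\cdots\circ g^1$. The procedural complexity $\mathcal{L}(h)$ is the shortest length of a program computing $h$; the identity has procedural complexity $0$. For a transformation $f$ of $A^n$, $D(f,m)$ is the set of transformations $h$ of $A^{n+m}$ such that $h_i(x_1,\dots,x_{n+m})=f_i(x_1,\dots,x_n)$ for all $1\le i\le n$ and all $(x_1,\dots,x_{n+m})\in A^{n+m}$. The shortest length of a program computing $f$ using $m$ memory cells is $\mathcal{L}(f|m):=\min_{h\in D(f,m)}\mathcal{L}(h)$. -}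

module Defs where

open import Data.Fin using (Fin; _↑ˡ_)
open import Data.Fin.Properties using (_≟_)
open import Data.Nat using (ℕ; _+_; _≤_)
open import Data.Product using (Σ; ∃-syntax; _×_; proj₁)
open import Data.Vec using (Vec; []; _∷_; lookup; tabulate; take; allFin; count)
open import Function using (id; _∘_)
open import Level using (Level)
open import Relation.Binary.PropositionalEquality using (_≡_; _≗_)
open import Relation.Nullary using (¬_)
open import Relation.Unary using (Pred)

private variable
  a ℓ : Level
  A : Set a
  m n N L : ℕ

-- Transformations are compared pointwise (_≗_), as there is no function
-- extensionality.
Transformation : Set a → ℕ → Set a
Transformation A N = Vec A N → Vec A N

TrivialAt : Transformation A N → Fin N → Set _
TrivialAt h i = ∀ x → lookup (h x) i ≡ lookup x i

IsInstruction : Transformation A N → Set _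
IsInstruction h = ∀ i j → ¬ TrivialAt h i → ¬ TrivialAt h j → i ≡ j

Instruction : Set a → ℕ → Set a
Instruction A N = Σ (Transformation A N) IsInstruction

Program : Set a → ℕ → ℕ → Set a
Program A N L = Vec (Instruction A N) L

-- The head of the vector is the instruction executed first.
run : Program A N L → Transformation A N
run []      = id
run (g ∷ p) = run p ∘ proj₁ g

_Computes_ : Program A N L → Transformation A N → Set _
p Computes h = run p ≗ h

IsMinimum : Pred ℕ ℓ → Pred ℕ ℓ
IsMinimum P k = P k × (∀ l → P l → k ≤ l)

-- Complexities are minima of sets of naturals whose non-emptiness is not
-- known in advance, so they are given as functional relations:
-- ProceduralComplexity h k is 𝓛(h) = k, and
-- ComplexityWithMemory f m k is 𝓛(f|m) = k.
ProceduralComplexity : Transformation A N → Pred ℕ _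
ProceduralComplexity {A = A} {N = N} h =
  IsMinimum λ L → Σ (Program A N L) (_Computes h)

-- The set D(f,m); the last m coordinates are the memory cells.
D : Transformation A n → (m : ℕ) → Pred (Transformation A (n + m)) _
D {n = n} f m h =
  ∀ i x → lookup (h x) (i ↑ˡ m) ≡ lookup (f (take n x)) i

ComplexityWithMemory : Transformation A n → ℕ → Pred ℕ _
ComplexityWithMemory f m =
  IsMinimum λ k → ∃[ h ] D f m h × ProceduralComplexity h k

manipulation : (Fin n → Fin n) → Transformation A n
manipulation φ x = tabulate (lookup x ∘ φ)

#fixedPoints : (Fin n → Fin n) → ℕ
#fixedPoints φ = count (λ i → φ i ≟ i) (allFin _)

{-# OPTIONS --safe #-}
module Submission where

-- Upper bound.  While φ misses some v, set x_v := x_{vφ}: the old x_v is not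
-- needed any more, and what remains is φ with v made a fixed point.  Once φ is
-- a permutation, store in the memory cell the sum of all cells modulo |A|, then
-- follow the nontrivial cycles one after another.  Starting a cycle destroys
-- the content of one cell, but the sum, being invariant under permutations of
-- the contents, recovers it from the other cells when the cycle closes.  So one
-- memory cell serves all cycles, and each moved variable costs one instruction.
--
-- Existence of the minimum.  As A is finite, an instruction is given by a
-- coordinate and a finite table, so programs of a given length can be searched.

open import Defs
open import Data.Empty using (⊥-elim)
open import Data.Fin using (Fin; zero; suc; toℕ; punchIn; punchOut; splitAt; _↑ˡ_; _↑ʳ_)
open import Data.Fin.Permutation using (transpose)
open import Data.Fin.Permutation.Components renaming (transpose to swap)
open import Data.Fin.Properties
  using (_≟_; any?; all?; ¬∀⟶∃¬; ↑ˡ-injective; punchInᵢ≢i; punchOut-injective; splitAt-↑ˡ; splitAt-↑ʳ;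
         <⇒notInjective; toℕ<n; toℕ-fromℕ<; toℕ-injective)
open import Data.Nat using (ℕ; zero; suc; _+_; _*_; _∸_; _≤_; _<_; z≤n; s≤s)
open import Data.Nat.DivMod
  using (_%_; _mod_; %-distribˡ-+; m%n<n; m%n%n≡m%n; [m+kn]%n≡m%n; m<n⇒m%n≡m)
open import Data.Nat.Properties
  using (≤-refl; ≤-reflexive; ≤-trans; <-≤-trans; n<1+n; m≤n⇒m≤1+n; m+n∸m≡n;
         +-comm; +-assoc; +-suc; *-suc; +-0-commutativeMonoid)
open import Algebra.Properties.CommutativeMonoid.Sum +-0-commutativeMonoid
  using (sum; sum-cong-≗; sum-permute; sum-remove)
open import Data.Product using (Σ; ∃; ∃-syntax; _×_; _,_; proj₁; proj₂)
open import Data.Vec using (Vec; []; _∷_; lookup; tabulate; take; allFin; count; _[_]≔_)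
open import Data.Vec.Functional using (removeAt)
open import Data.Vec.Membership.Propositional using (_∈_)
open import Data.Vec.Membership.Propositional.Properties using (∈-allFin⁺)
open import Data.Vec.Properties
  using (lookup∘tabulate; lookup∘update; lookup∘update′; tabulate∘lookup; tabulate-cong)
open import Data.Vec.Relation.Unary.Any using (here; there)
open import Function using (_∘_; id)
open import Function.Bundles using (_↔_; Inverse)
open import Function.Definitions using (Injective)
open import Level using (Level)
open import Relation.Binary using (DecidableEquality)
open import Relation.Binary.PropositionalEquality
  using (_≡_; _≢_; _≗_; refl; sym; trans; cong; cong₂; subst; module ≡-Reasoning)
open import Relation.Nullary using (Dec; yes; no; ¬_; contradiction)
open import Relation.Nullary.Decidable using (map′; ¬?; decidable-stable; _×-dec_)
open import Relation.Unary using (Pred; Decidable)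

private variable
  a ℓ ℓ′ : Level
  X : Set a
  n : ℕ

-- Counting

module _ {P : Pred X ℓ} {Q : Pred X ℓ′} (P? : Decidable P) (Q? : Decidable Q)
         (P⊆Q : ∀ x → P x → Q x) where

  count-mono : (xs : Vec X n) → count P? xs ≤ count Q? xs
  count-mono [] = z≤n
  count-mono (x ∷ xs) with P? x | Q? x
  ... | yes _ | yes _ = s≤s (count-mono xs)
  ... | yes p | no ¬q = contradiction (P⊆Q x p) ¬q
  ... | no _  | yes _ = m≤n⇒m≤1+n (count-mono xs)
  ... | no _  | no _  = count-mono xs

  count-mono-< : ∀ {y} {xs : Vec X n} → y ∈ xs → Q y → ¬ P y →
                 count P? xs < count Q? xs
  count-mono-< {xs = x ∷ xs} (here refl) q ¬p with P? x | Q? x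
  ... | yes p | _     = contradiction p ¬p
  ... | no _  | yes _ = s≤s (count-mono xs)
  ... | no _  | no ¬q = contradiction q ¬q
  count-mono-< {xs = x ∷ xs} (there y∈xs) q ¬p with P? x | Q? x
  ... | yes _ | yes _ = s≤s (count-mono-< y∈xs q ¬p)
  ... | yes p | no ¬q = contradiction (P⊆Q x p) ¬q
  ... | no _  | yes _ = m≤n⇒m≤1+n (count-mono-< y∈xs q ¬p)
  ... | no _  | no _  = count-mono-< y∈xs q ¬p

count-¬ : {P : Pred X ℓ} (P? : Decidable P) (xs : Vec X n) →
          count P? xs + count (¬? ∘ P?) xs ≡ n
count-¬ P? [] = refl
count-¬ P? (x ∷ xs) with P? x
... | yes _ = cong suc (count-¬ P? xs)
... | no _  = trans (+-suc _ _) (cong suc (count-¬ P? xs))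

moved? : (ψ : Fin n → Fin n) → Decidable (λ i → ψ i ≢ i)
moved? ψ i = ¬? (ψ i ≟ i)

#moved : (Fin n → Fin n) → ℕ
#moved ψ = count (moved? ψ) (allFin _)

n∸#fixedPoints≡#moved : (ψ : Fin n → Fin n) → n ∸ #fixedPoints ψ ≡ #moved ψ
n∸#fixedPoints≡#moved {n} ψ =
  trans (cong (_∸ #fixedPoints ψ) (sym (count-¬ (λ i → ψ i ≟ i) (allFin n))))
        (m+n∸m≡n (#fixedPoints ψ) (#moved ψ))

-- Maps between finite sets

-- If `j` were missed, punching it out of the codomain would inject `Fin (suc n)` into `Fin n`.
injective⇒surjective : {f : Fin n → Fin n} → Injective _≡_ _≡_ f →
                       ∀ j → ∃[ i ] f i ≡ j
injective⇒surjective {suc n} {f} inj j with any? (λ i → f i ≟ j)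
... | yes hit = hit
... | no ¬hit = ⊥-elim (<⇒notInjective (n<1+n n) avoid-injective)
  where
  j≢f : ∀ i → j ≢ f i
  j≢f i j≡fi = ¬hit (i , sym j≡fi)

  avoid-injective : Injective _≡_ _≡_ (λ i → punchOut (j≢f i))
  avoid-injective {x} {y} eq = inj (punchOut-injective (j≢f x) (j≢f y) eq)

-- A choice of preimages is an injective section, hence surjective. So `x` and `y` are themselves
-- chosen preimages, and these are determined by their images.
surjective⇒injective : {f : Fin n → Fin n} → (∀ j → ∃[ i ] f i ≡ j) →
                       Injective _≡_ _≡_ f
surjective⇒injective {f = f} surj {x} {y} fx≡fy
  with injective⇒surjective section-injective x
     | injective⇒surjective section-injective y
  where
  section-injective : Injective _≡_ _≡_ (proj₁ ∘ surj)
  section-injective {i} {j} eq =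
    trans (sym (proj₂ (surj i))) (trans (cong f eq) (proj₂ (surj j)))
... | i , refl | j , refl =
  cong (proj₁ ∘ surj)
       (trans (sym (proj₂ (surj i))) (trans fx≡fy (proj₂ (surj j))))

swap-left : (i j : Fin n) → swap i j i ≡ j
swap-left i j with i ≟ i
... | yes _ = refl
... | no i≢i = contradiction refl i≢i

swap-right : (i j : Fin n) → swap i j j ≡ i
swap-right i j with j ≟ i
... | yes j≡i = j≡i
... | no _ with j ≟ j
...   | yes _ = refl
...   | no j≢j = contradiction refl j≢j

swap-other : {i j k : Fin n} → k ≢ i → k ≢ j → swap i j k ≡ k
swap-other {i = i} {j} {k} k≢i k≢j with k ≟ i
... | yes k≡i = contradiction k≡i k≢i
... | no _ with k ≟ j
...   | yes k≡j = contradiction k≡j k≢j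
...   | no _ = refl

swap-involutive : (i j k : Fin n) → swap i j (swap i j k) ≡ k
swap-involutive i j k = by-position (k ≟ i) (k ≟ j)
  where
  by-position : Dec (k ≡ i) → Dec (k ≡ j) → swap i j (swap i j k) ≡ k
  by-position (yes refl) _          =
    trans (cong (swap i j) (swap-left i j)) (swap-right i j)
  by-position (no _)     (yes refl) =
    trans (cong (swap i j) (swap-right i j)) (swap-left i j)
  by-position (no k≢i)   (no k≢j)   =
    trans (cong (swap i j) (swap-other k≢i k≢j)) (swap-other k≢i k≢j)

swap-injective : (i j : Fin n) → Injective _≡_ _≡_ (swap i j)
swap-injective i j {x} {y} eq =
  trans (sym (swap-involutive i j x))
        (trans (cong (swap i j) eq) (swap-involutive i j y))

-- Least elements and exhaustive search

least : {P : Pred ℕ ℓ} → Decidable P → ∀ b → P b → ∃[ k ] IsMinimum P k × k ≤ b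
least P? zero p = zero , (p , λ _ _ → z≤n) , z≤n
least {P = P} P? (suc b) p with P? zero
... | yes p₀ = zero , (p₀ , λ _ _ → z≤n) , z≤n
... | no ¬p₀ with least (P? ∘ suc) b p
...   | k , (pk , k-least) , k≤b = suc k , (pk , suc-least) , s≤s k≤b
  where
  suc-least : ∀ l → P l → suc k ≤ l
  suc-least zero    p₀ = contradiction p₀ ¬p₀
  suc-least (suc l) pl = s≤s (k-least l pl)

Searchable : ∀ {x} ℓ → Set x → Set _
Searchable ℓ X = {P : Pred X ℓ} → Decidable P → Dec (∃ P)

search-all : Searchable ℓ X → {P : Pred X ℓ} → Decidable P → Dec (∀ x → P x)
search-all search P? =
  map′ (λ ¬∃¬ x → decidable-stable (P? x) (λ ¬p → ¬∃¬ (x , ¬p)))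
       (λ ∀p (x , ¬p) → ¬p (∀p x))
       (¬? (search (¬? ∘ P?)))

-- Predicates and elements share the level `a`, so that the inner search over tails again decides a
-- predicate of level `a`.
search-Vec : {X : Set a} → Searchable a X → ∀ n → Searchable a (Vec X n)
search-Vec search zero P? =
  map′ (λ p → [] , p) (λ { ([] , p) → p }) (P? [])
search-Vec search (suc n) P? =
  map′ (λ (x , xs , p) → x ∷ xs , p) (λ { (x ∷ xs , p) → x , xs , p })
       (search (λ x → search-Vec search n (λ xs → P? (x ∷ xs))))

lookup-take : ∀ m (xs : Vec X (n + m)) i → lookup (take n xs) i ≡ lookup xs (i ↑ˡ m)
lookup-take m (x ∷ xs) zero    = refl
lookup-take m (x ∷ xs) (suc i) = lookup-take m xs i

-- Deciding the existence of programs over a finite alphabet.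

module FiniteAlphabet {a} {A : Set a} {q : ℕ} (A↔Fin : A ↔ Fin q) where
  open Inverse A↔Fin using (to; from; strictlyInverseˡ; strictlyInverseʳ)

  _≟A_ : DecidableEquality A
  x ≟A y = map′
    (λ eq → trans (sym (strictlyInverseʳ x)) (trans (cong from eq) (strictlyInverseʳ y)))
    (cong to) (to x ≟ to y)

  search-A : Searchable ℓ A
  search-A {P = P} P? =
    map′ (λ (i , p) → from i , p)
         (λ (x , p) → to x , subst P (sym (strictlyInverseʳ x)) p)
         (any? (P? ∘ from))

  -- Value tables as `q`-ary trees of depth `N`. They can be searched exhaustively and represent
  -- every function `Vec A N → A` pointwise.
  Table : ℕ → Set a
  Table zero    = A
  Table (suc N) = Vec (Table N) q

  apply : ∀ {N} → Table N → Vec A N → A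
  apply t []       = t
  apply t (x ∷ xs) = apply (lookup t (to x)) xs

  table : ∀ {N} → (Vec A N → A) → Table N
  table {zero}  e = e []
  table {suc N} e = tabulate (λ i → table (λ xs → e (from i ∷ xs)))

  apply-table : ∀ {N} (e : Vec A N → A) → apply (table e) ≗ e
  apply-table e [] = refl
  apply-table e (x ∷ xs)
    rewrite lookup∘tabulate (λ i → table (λ xs → e (from i ∷ xs))) (to x) =
    trans (apply-table (λ xs → e (from (to x) ∷ xs)) xs)
          (cong (λ y → e (y ∷ xs)) (strictlyInverseʳ x))

  search-Table : ∀ N → Searchable a (Table N)
  search-Table zero    = search-A
  search-Table (suc N) = search-Vec (search-Table N) q

  assign : ∀ {N} → Fin N → (Vec A N → A) → Instruction A N
  assign {N} i e = (λ x → x [ i ]≔ e x) , λ j k ¬tj ¬tk → trans (at-i j ¬tj) (sym (at-i k ¬tk))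
    where
    at-i : ∀ j → ¬ TrivialAt (λ x → x [ i ]≔ e x) j → j ≡ i
    at-i j ¬trivial =
      decidable-stable (j ≟ i) (λ j≢i → ¬trivial (λ x → lookup∘update′ j≢i x (e x)))

  trivialAt? : ∀ {N} (h : Transformation A N) i → Dec (TrivialAt h i)
  trivialAt? {N} h i =
    search-all (search-Vec search-A N) (λ x → lookup (h x) i ≟A lookup x i)

  lookup-injective : ∀ {N} {x y : Vec A N} → lookup x ≗ lookup y → x ≡ y
  lookup-injective {x = x} {y} eq =
    trans (sym (tabulate∘lookup x)) (trans (tabulate-cong eq) (tabulate∘lookup y))

  assign-correct : ∀ {N} (g : Instruction A N) →
    ∀ i → (∀ j → j ≢ i → TrivialAt (proj₁ g) j) →
    proj₁ g ≗ proj₁ (assign i (apply (table (λ x → lookup (proj₁ g x) i))))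
  assign-correct (g , _) i elsewhere x = lookup-injective agree
    where
    t = table (λ x → lookup (g x) i)

    agree : ∀ j → lookup (g x) j ≡ lookup (x [ i ]≔ apply t x) j
    agree j with j ≟ i
    ... | yes refl = sym (trans (lookup∘update i x _) (apply-table _ x))
    ... | no j≢i   = trans (elsewhere j j≢i x) (sym (lookup∘update′ j≢i x _))

  -- Triviality is decidable. If a nontrivial coordinate is found, all others are trivial; if there
  -- is none, coordinate `zero` is overwritten with its own value.
  instruction-code : ∀ {N} (g : Instruction A (suc N)) →
    ∃[ i ] ∃[ t ] proj₁ g ≗ proj₁ (assign i (apply t))
  instruction-code g@(h , inst) with any? (λ i → ¬? (trivialAt? h i))
  ... | yes (i , ¬trivial) = i , _ , assign-correct g i λ j j≢i →
          decidable-stable (trivialAt? h j) (λ ¬trivialⱼ → j≢i (inst j i ¬trivialⱼ ¬trivial))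
  ... | no ¬nontrivial = zero , _ , assign-correct g zero λ j _ →
          decidable-stable (trivialAt? h j) (λ ¬trivialⱼ → ¬nontrivial (j , ¬trivialⱼ))

  -- `Q` has to respect `_≗_` because the search runs over coded instructions, which agree with
  -- given ones only pointwise.
  search-Program : ∀ {N} L {Q : Pred (Transformation A (suc N)) a} →
    (∀ {g h} → g ≗ h → Q g → Q h) → Decidable Q →
    Dec (Σ (Program A (suc N) L) (Q ∘ run))
  search-Program zero resp Q? = map′ (λ p → [] , p) (λ { ([] , p) → p }) (Q? id)
  search-Program {N} (suc L) {Q} resp Q? =
    map′ (λ (i , t , p , qp) → assign i (apply t) ∷ p , qp) encode
      (any? λ i → search-Table (suc N) λ t →
        search-Program L (λ eq → resp (eq ∘ proj₁ (assign i (apply t))))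
          (λ h → Q? (h ∘ proj₁ (assign i (apply t)))))
    where
    encode : Σ (Program A (suc N) (suc L)) (Q ∘ run) →
      ∃[ i ] ∃[ t ] Σ (Program A (suc N) L) λ p → Q (run p ∘ proj₁ (assign i (apply t)))
    encode (g ∷ p , qp) with instruction-code g
    ... | i , t , eq = i , t , p , resp (cong (run p) ∘ eq) qp

  D-resp : ∀ {m} (f : Transformation A n) {g h} → g ≗ h → D f m g → D f m h
  D-resp {m = m} f eq g∈D i x =
    trans (cong (λ y → lookup y (i ↑ˡ m)) (sym (eq x))) (g∈D i x)

  D? : ∀ {m} (f : Transformation A n) → Decidable (D f m)
  D? {n} {m} f h = all? λ i → search-all (search-Vec search-A (n + m)) λ x →
    lookup (h x) (i ↑ˡ m) ≟A lookup (f (take n x)) i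

  -- The minimum over `D f m` of procedural complexities is the least length of a program whose run
  -- lies in `D f m`. The run of such a shortest program is the witness: any program computing the
  -- same transformation also lands in `D f m`, so it is no shorter.
  complexity-bound : ∀ {m} (f : Transformation A (suc n)) b →
    Σ (Program A (suc n + m) b) (D f m ∘ run) →
    ∃[ k ] ComplexityWithMemory f m k × k ≤ b
  complexity-bound f b p
    with least (λ L → search-Program L (D-resp f) (D? f)) b p
  ... | k , ((p , p∈D) , k-least) , k≤b = k , ((run p , p∈D , (p , λ _ → refl) ,
          λ l (p′ , p′≗p) → k-least l (p′ , D-resp f (sym ∘ p′≗p) p∈D)) ,
        λ { l (h , h∈D , (p′ , p′≗h) , _) → k-least l (p′ , D-resp f (sym ∘ p′≗h) h∈D) }) , k≤b

-- Programs for manipulations of variables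

module UpperBound {a} {A : Set a} {q n : ℕ} (A↔Fin : A ↔ Fin (suc q)) where
  open Inverse A↔Fin using (to; from; strictlyInverseˡ; strictlyInverseʳ)
  open FiniteAlphabet A↔Fin using (assign)

  State : Set a
  State = Vec A (suc n + 1)

  cell : Fin (suc n) → Fin (suc n + 1)
  cell i = i ↑ˡ 1

  mem : Fin (suc n + 1)
  mem = suc n ↑ʳ zero

  cells : State → Fin (suc n) → A
  cells x i = lookup x (cell i)

  memory : State → A
  memory x = lookup x mem

  cell≢mem : ∀ i → cell i ≢ mem
  cell≢mem i eq with trans (sym (splitAt-↑ˡ (suc n) i 1))
                           (trans (cong (splitAt (suc n)) eq) (splitAt-↑ʳ (suc n) 1 zero))
  ... | ()

  setCell : Fin (suc n) → (State → A) → Instruction A (suc n + 1)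
  setCell = assign ∘ cell

  module _ (i : Fin (suc n)) (e : State → A) (x : State) where

    private x′ = proj₁ (setCell i e) x

    cells-setCell : cells x′ i ≡ e x
    cells-setCell = lookup∘update (cell i) x (e x)

    cells-setCell-other : ∀ {j} → j ≢ i → cells x′ j ≡ cells x j
    cells-setCell-other j≢i =
      lookup∘update′ (j≢i ∘ ↑ˡ-injective 1 _ _) x (e x)

    memory-setCell : memory x′ ≡ memory x
    memory-setCell = lookup∘update′ (cell≢mem i ∘ sym) x (e x)

  -- Checksums modulo the alphabet size.

  code : (Fin (suc n) → A) → Fin (suc n) → ℕ
  code z = toℕ ∘ to ∘ z

  checksum : (Fin (suc n) → A) → A
  checksum z = from (sum (code z) mod suc q)

  checksum-cong : ∀ {y z} → y ≗ z → checksum y ≡ checksum z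
  checksum-cong eq =
    cong (λ s → from (s mod suc q)) (sum-cong-≗ (cong (toℕ ∘ to) ∘ eq))

  checksum-swap : ∀ z i j → checksum (z ∘ swap i j) ≡ checksum z
  checksum-swap z i j =
    cong (λ s → from (s mod suc q)) (sym (sum-permute (code z) (transpose i j)))

  -- q ≡ -1 modulo the alphabet size, so this subtracts the cells other than h from s.
  restore : Fin (suc n) → A → (Fin (suc n) → A) → A
  restore h s y = from ((toℕ (to s) + sum (removeAt (code y) h) * q) mod suc q)

  -- With `c` the code of the lost content and `r` the sum of the others, `c + r + r * q` is
  -- `c + r * suc q`, which leaves remainder `c`. The value `y h` is never read.
  restore-checksum : ∀ {h y z} → (∀ i → i ≢ h → y i ≡ z i) →
                     restore h (checksum z) y ≡ z h
  restore-checksum {h} {y} {z} agree =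
    trans (cong from (toℕ-injective recovered)) (strictlyInverseʳ (z h))
    where
    open ≡-Reasoning
    c = code z h
    r = sum (removeAt (code z) h)
    rest : sum (removeAt (code y) h) ≡ r
    rest = sum-cong-≗ (λ i → cong (toℕ ∘ to) (agree (punchIn h i) (punchInᵢ≢i h i)))

    toℕ-mod : ∀ m → toℕ (m mod suc q) ≡ m % suc q
    toℕ-mod m = toℕ-fromℕ< (m%n<n m (suc q))

    +-%-absorbˡ : ∀ k l → (k % suc q + l) % suc q ≡ (k + l) % suc q
    +-%-absorbˡ k l = begin
      (k % suc q + l) % suc q                     ≡⟨ %-distribˡ-+ (k % suc q) l (suc q) ⟩
      (k % suc q % suc q + l % suc q) % suc q     ≡⟨ cong (λ m → (m + l % suc q) % suc q) (m%n%n≡m%n k (suc q)) ⟩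
      (k % suc q + l % suc q) % suc q             ≡⟨ %-distribˡ-+ k l (suc q) ⟨
      (k + l) % suc q                             ∎

    recovered : toℕ ((toℕ (to (checksum z)) + sum (removeAt (code y) h) * q) mod suc q)
                ≡ toℕ (to (z h))
    recovered = begin
      toℕ ((toℕ (to (checksum z)) + sum (removeAt (code y) h) * q) mod suc q)
        ≡⟨ toℕ-mod (toℕ (to (checksum z)) + sum (removeAt (code y) h) * q) ⟩
      (toℕ (to (checksum z)) + sum (removeAt (code y) h) * q) % suc q
        ≡⟨ cong₂ (λ s t → (toℕ s + t * q) % suc q) (strictlyInverseˡ (sum (code z) mod suc q)) rest ⟩
      (toℕ (sum (code z) mod suc q) + r * q) % suc q
        ≡⟨ cong (λ s → (s + r * q) % suc q) (toℕ-mod (sum (code z))) ⟩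
      (sum (code z) % suc q + r * q) % suc q
        ≡⟨ +-%-absorbˡ (sum (code z)) (r * q) ⟩
      (sum (code z) + r * q) % suc q
        ≡⟨ cong (λ s → (s + r * q) % suc q) (sum-remove (code z)) ⟩
      (c + r + r * q) % suc q
        ≡⟨ cong (_% suc q) (trans (+-assoc c r (r * q)) (cong (c +_) (sym (*-suc r q)))) ⟩
      (c + r * suc q) % suc q
        ≡⟨ [m+kn]%n≡m%n c r (suc q) ⟩
      c % suc q
        ≡⟨ m<n⇒m%n≡m (toℕ<n (to (z h))) ⟩
      c ∎

  -- The length is only bounded by `k`, which lets recursion follow a count that drops by at least
  -- one per instruction.
  record Within (k : ℕ) (R : State → State → Set a) : Set a where
    constructor within
    field
      {len}   : ℕ
      len≤    : len ≤ k
      program : Program A (suc n + 1) len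
      correct : ∀ x → R x (run program x)

  module _ {R : State → State → Set a} where

    idle : ∀ {k} → (∀ x → R x x) → Within k R
    idle = within z≤n []

    _then_ : ∀ {k} {R′} (g : Instruction A (suc n + 1)) → Within k R′ →
             (∀ {x y} → R′ (proj₁ g x) y → R x y) → Within (suc k) R
    (g then within L≤k p spec) R′⇒R = within (s≤s L≤k) (g ∷ p) (R′⇒R ∘ spec ∘ proj₁ g)

    relax : ∀ {k l} → k ≤ l → Within k R → Within l R
    relax k≤l (within L≤k p spec) = within (≤-trans L≤k k≤l) p spec

  -- Permutations: following the cycles with a moving hole.

  Manipulates : (Fin (suc n) → Fin (suc n)) → State → State → Set a
  Manipulates ψ x y = cells y ≗ cells x ∘ ψ

  -- x holds z, except that the content of cell h is lost and recoverable only via memory.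
  record HoledState (h : Fin (suc n)) (z : Fin (suc n) → A) (x : State) : Set a where
    field
      cells≡    : ∀ i → i ≢ h → cells x i ≡ z i
      checksum≡ : memory x ≡ checksum z
  open HoledState

  -- The contents `z` exist only in the specification: the program sees `x` and must succeed for
  -- every `z` that `x` represents.
  ManipulatesHoled : Fin (suc n) → (Fin (suc n) → Fin (suc n)) → State → State → Set a
  ManipulatesHoled h ψ x y = ∀ z → HoledState h z x → cells y ≗ z ∘ ψ

  -- Leaving out the hole makes the count drop both when the hole advances along its cycle and when
  -- it jumps to a new cycle.
  movedOff? : ∀ h (ψ : Fin (suc n) → Fin (suc n)) → Decidable (λ i → i ≢ h × ψ i ≢ i)
  movedOff? h ψ i = ¬? (i ≟ h) ×-dec moved? ψ i

  #movedOff : Fin (suc n) → (Fin (suc n) → Fin (suc n)) → ℕ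
  #movedOff h ψ = count (movedOff? h ψ) (allFin _)

  module _ (h : Fin (suc n)) (ψ : Fin (suc n) → Fin (suc n)) where

    lost fetched : State → A
    lost x   = restore h (memory x) (cells x)
    fetched x = cells x (ψ h)

    fillHole fetch : Instruction A (suc n + 1)
    fillHole = setCell h lost
    fetch = setCell h fetched

    cells-fillHole : ∀ {x z} → HoledState h z x → cells (proj₁ fillHole x) ≗ z
    cells-fillHole {x} holed i with i ≟ h
    ... | yes refl = trans (cells-setCell h lost x)
            (trans (cong (λ s → restore h s (cells x)) (checksum≡ holed))
                   (restore-checksum (cells≡ holed)))
    ... | no i≢h = trans (cells-setCell-other h lost x i≢h) (cells≡ holed i i≢h)

    -- After the fill no content is lost, so any cell `c` may be declared the new hole.
    fillHole-holed : ∀ {x z} c → HoledState h z x → HoledState c z (proj₁ fillHole x)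
    fillHole-holed {x} c holed .cells≡ i _ = cells-fillHole holed i
    fillHole-holed {x} c holed .checksum≡ =
      trans (memory-setCell h lost x) (checksum≡ holed)

    -- Cell `h` now holds `z (ψ h)`, and `ψ h` becomes the hole, whose nominal content is the lost
    -- `z h`. This exchange of two contents leaves the checksum unchanged.
    fetch-holed : ∀ {x z} → ψ h ≢ h → HoledState h z x →
      HoledState (ψ h) (z ∘ swap h (ψ h)) (proj₁ fetch x)
    fetch-holed {x} {z} ψh≢h holed .cells≡ i i≢ψh with i ≟ h
    ... | yes refl = trans (cells-setCell h fetched x) (cells≡ holed (ψ h) ψh≢h)
    ... | no i≢h with i ≟ ψ h
    ...   | yes i≡ψh = contradiction i≡ψh i≢ψh
    ...   | no _ = trans (cells-setCell-other h fetched x i≢h) (cells≡ holed i i≢h)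
    fetch-holed {x} {z} ψh≢h holed .checksum≡ =
      trans (memory-setCell h fetched x) (trans (checksum≡ holed) (sym (checksum-swap z h (ψ h))))

    -- The new map fixes `h` and moves no point that `ψ` fixes. The strict drop comes from `ψ h`: it
    -- was counted, being moved by injectivity, and is now the hole.
    #movedOff-fetch : Injective _≡_ _≡_ ψ → ψ h ≢ h →
      #movedOff (ψ h) (swap h (ψ h) ∘ ψ) < #movedOff h ψ
    #movedOff-fetch inj ψh≢h =
      count-mono-< (movedOff? (ψ h) ψ′) (movedOff? h ψ) shrinks (∈-allFin⁺ (ψ h))
        (ψh≢h , ψh≢h ∘ inj) (λ (ψh≢ψh , _) → ψh≢ψh refl)
      where
      ψ′ = swap h (ψ h) ∘ ψ

      shrinks : ∀ i → i ≢ ψ h × ψ′ i ≢ i → i ≢ h × ψ i ≢ i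
      shrinks i (i≢ψh , ψ′i≢i) = i≢h , λ ψi≡i →
          ψ′i≢i (trans (cong (swap h (ψ h)) ψi≡i) (swap-other i≢h i≢ψh))
        where
        i≢h : i ≢ h
        i≢h refl = ψ′i≢i (swap-right h (ψ h))

    #movedOff-fillHole : ∀ {c} → ψ h ≡ h → ψ c ≢ c → #movedOff c ψ < #movedOff h ψ
    #movedOff-fillHole {c} ψh≡h ψc≢c =
      count-mono-< (movedOff? c ψ) (movedOff? h ψ)
        (λ i (_ , ψi≢i) → (λ { refl → ψi≢i ψh≡h }) , ψi≢i) (∈-allFin⁺ c)
        ((λ { refl → ψc≢c ψh≡h }) , ψc≢c) (λ (c≢c , _) → c≢c refl)

  -- If `ψ` moves `h`, a fetch settles `h`, and what remains is `ψ` with `h` cut out of its cycle.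
  -- If `ψ` fixes `h`, the cycle has closed: the hole is filled and reopened at a moved cell, or the
  -- program ends. The strict bound reserves one instruction for the last fill.
  manipulateHoled : ∀ k h ψ → Injective _≡_ _≡_ ψ → #movedOff h ψ < k →
                    Within k (ManipulatesHoled h ψ)
  manipulateHoled (suc k) h ψ inj (s≤s bound) with ψ h ≟ h
  ... | no ψh≢h =
    (fetch h ψ then
       manipulateHoled k (ψ h) (swap h (ψ h) ∘ ψ) (inj ∘ swap-injective h (ψ h))
         (<-≤-trans (#movedOff-fetch h ψ inj ψh≢h) bound))
    -- The swap of the contents cancels the swap in the remaining map.
    (λ spec z holed i →
       trans (spec _ (fetch-holed h ψ ψh≢h holed) i)
             (cong z (swap-involutive h (ψ h) (ψ i))))
  ... | yes ψh≡h with any? (moved? ψ)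
  ...   | yes (c , ψc≢c) =
    (fillHole h ψ then
       manipulateHoled k c ψ inj (<-≤-trans (#movedOff-fillHole h ψ ψh≡h ψc≢c) bound))
    (λ spec z holed → spec z (fillHole-holed h ψ c holed))
  ...   | no ¬moved =
    (fillHole h ψ then idle {R = λ x y → y ≡ x} (λ _ → refl))
    (λ { {x} refl z holed i → trans (cells-fillHole h ψ holed i)
         (cong z (sym (decidable-stable (ψ i ≟ i) (λ ψi≢i → ¬moved (i , ψi≢i))))) })

  manipulate-injective : ∀ ψ → Injective _≡_ _≡_ ψ →
                         Within (suc (#moved ψ)) (Manipulates ψ)
  manipulate-injective ψ inj with any? (moved? ψ)
  ... | no ¬moved = idle λ x i →
    cong (cells x) (sym (decidable-stable (ψ i ≟ i) (λ ψi≢i → ¬moved (i , ψi≢i))))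
  ... | yes (c , ψc≢c) =
    -- Nothing is lost yet, but calling the moved cell `c` the hole takes it off the count, so
    -- `#moved ψ` instructions suffice after the save.
    (assign mem (checksum ∘ cells) then
       manipulateHoled (#moved ψ) c ψ inj
         (count-mono-< (movedOff? c ψ) (moved? ψ) (λ _ → proj₂) (∈-allFin⁺ c)
           ψc≢c (λ (c≢c , _) → c≢c refl)))
    (λ {x} spec → spec (cells x) (saved x))
    where
    saved : ∀ x → HoledState c (cells x) (proj₁ (assign mem (checksum ∘ cells)) x)
    saved x .cells≡ i _ = lookup∘update′ (cell≢mem i) x _
    saved x .checksum≡ = lookup∘update mem x _

  -- Reduction of arbitrary maps to permutations.

  fixAt : Fin (suc n) → (Fin (suc n) → Fin (suc n)) → Fin (suc n) → Fin (suc n)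
  fixAt v ψ i with i ≟ v
  ... | yes _ = v
  ... | no _  = ψ i

  #moved-fixAt : ∀ v ψ → ψ v ≢ v → #moved (fixAt v ψ) < #moved ψ
  #moved-fixAt v ψ ψv≢v =
    count-mono-< (moved? (fixAt v ψ)) (moved? ψ) shrinks (∈-allFin⁺ v) ψv≢v fixed
    where
    shrinks : ∀ i → fixAt v ψ i ≢ i → ψ i ≢ i
    shrinks i moved with i ≟ v
    ... | yes refl = contradiction refl moved
    ... | no _ = moved
    fixed : ¬ (fixAt v ψ v ≢ v)
    fixed with v ≟ v
    ... | yes _ = λ v≢v → v≢v refl
    ... | no v≢v = contradiction refl v≢v

  -- Each fetch into a missed cell uses up one moved variable; the extra instruction in `suc k` is
  -- kept for saving the checksum once the map is a permutation.
  manipulate : ∀ k ψ → #moved ψ ≤ k → Within (suc k) (Manipulates ψ)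
  manipulate k ψ bound with all? (λ v → any? (λ i → ψ i ≟ v))
  ... | yes surj = relax (s≤s bound) (manipulate-injective ψ (surjective⇒injective surj))
  ... | no ¬surj with ¬∀⟶∃¬ _ _ (λ v → any? (λ i → ψ i ≟ v)) ¬surj
  -- A missed `v` is in particular moved, so `#moved` drops strictly, which rules out `k = 0`.
  ...   | v , v∉ψ with k | <-≤-trans (#moved-fixAt v ψ (λ ψv≡v → v∉ψ (v , ψv≡v))) bound
  ...     | suc k | s≤s bound′ =
    (fetch v ψ then manipulate k (fixAt v ψ) bound′)
    (λ {x} spec i → trans (spec i) (read x i))
    where
    -- Overwriting cell `v` is harmless, as no `ψ i` equals `v`.
    read : ∀ x i → cells (proj₁ (fetch v ψ) x) (fixAt v ψ i) ≡ cells x (ψ i)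
    read x i with i ≟ v
    ... | yes refl = cells-setCell v (fetched v ψ) x
    ... | no _     = cells-setCell-other v (fetched v ψ) x (λ ψi≡v → v∉ψ (i , ψi≡v))

proposition14 : ∀ {a} (A : Set a) (q : ℕ) → A ↔ Fin q → 2 ≤ q →
    (n : ℕ) → 2 ≤ n →
    (φ : Fin n → Fin n) →
    ∃[ k ] ComplexityWithMemory {A = A} (manipulation φ) 1 k × k ≤ (n ∸ #fixedPoints φ) + 1
proposition14 A (suc q) A↔Fin _ (suc n) _ φ
  with UpperBound.manipulate A↔Fin (#moved φ) φ ≤-refl
... | UpperBound.within {L} L≤ p spec
  with FiniteAlphabet.complexity-bound A↔Fin (manipulation φ) L (p , in-D)
  where
  in-D : D (manipulation φ) 1 (run p)
  in-D i x = trans (spec x i) (sym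
    (trans (lookup∘tabulate (lookup (take (suc n) x) ∘ φ) i) (lookup-take 1 x (φ i))))
... | k , minimum , k≤L = k , minimum , ≤-trans k≤L (≤-trans L≤ (≤-reflexive
  (trans (+-comm 1 (#moved φ)) (cong (_+ 1) (sym (n∸#fixedPoints≡#moved φ))))))
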